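{- (GBC) The ideal $V$ (the collection of all subclasses of $V$ that are sets) is the unique minimal access ideal for $V$: any (definable) ideal on $V$ that is a minimal access ideal for $V$ equals $V$.
   Context: GBC is Gödel–Bernays class theory with choice. An ideal on a class (or set) $X$ is a (definable) collection $\mathcal I$ of subclasses of $X$ such that (i) $Y_1,Y_2\in\mathcal I\Rightarrow Y_1\cup Y_2\in\mathcal I$, (ii) $Y\in\mathcal I$, $Z\subseteq Y\Rightarrow Z\in\mathcal I$, (iii) $X\notin\mathcal I$. A preordering of $X$ is a reflexive, transitive, total binary relation $\preccurlyeq$ on $X$; throughout, all preorderings are assumed to have no last element. For $x\in X$ let ${\preccurlyeq_x}=\{y\in X:y\preccurlyeq x\}$. A subclass $Y\subseteq X$ is $\preccurlyeq$-bounded if $Y\subseteq{\preccurlyeq_x}$ for some $x\in X$; otherwise it is cofinal. $Seg(\preccurlyeq)$ denotes the ideal of $\preccurlyeq$-bounded subclasses of $X$. An ideal $\mathcal I$ on $X$ is an access ideal for $X$ ($X$ is $\mathcal I$-accessible) if there is a preordering $\preccurlyeq$ of $X$ with $Seg(\preccurlyeq)\subseteq\mathcal I$; such $\preccurlyeq$ is called an $\mathcal I$-preordering. $\mathcal I$ is a minimal access ideal for $X$ if it is an access ideal for $X$ and for no ideal $\mathcal J\subsetneq\mathcal I$ is $X$ $\mathcal J$-accessible. -}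

module Defs where

open import Data.Empty using (⊥)
open import Data.Fin using (Fin; zero)
open import Data.Nat using (ℕ; suc)
open import Data.Product using (Σ; ∃; ∃-syntax; _×_; _,_; proj₁)
open import Data.Sum using (_⊎_)
open import Data.Unit using (⊤)
open import Data.Vec using (Vec; []; _∷_; lookup)
open import Function.Bundles using (_⇔_)
open import Level using (Level) renaming (suc to lsuc)
open import Relation.Binary.PropositionalEquality using (_≡_)
open import Relation.Nullary using (¬_)
import Relation.Unary as U

-- First-order formulas of class theory with n free variables (de Bruijn
-- indices).  All variables range over classes; ∀ˢ and ∃ˢ are the
-- quantifiers relativised to sets.

infix  8 _∈̇_ _≡̇_
infix  7 ¬̇_
infixr 6 _∧̇_
infixr 5 _∨̇_
infixr 4 _⇒̇_

data Formula (n : ℕ) : Set where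
  _∈̇_ _≡̇_        : Fin n → Fin n → Formula n
  ¬̇_             : Formula n → Formula n
  _∧̇_ _∨̇_ _⇒̇_    : Formula n → Formula n → Formula n
  ∀ˢ_ ∃ˢ_ ∀ᶜ_ ∃ᶜ_ : Formula (suc n) → Formula n

-- No class quantifiers; class parameters are allowed.

Elementary : ∀ {n} → Formula n → Set
Elementary (x ∈̇ y) = ⊤
Elementary (x ≡̇ y) = ⊤
Elementary (¬̇ φ)   = Elementary φ
Elementary (φ ∧̇ ψ) = Elementary φ × Elementary ψ
Elementary (φ ∨̇ ψ) = Elementary φ × Elementary ψ
Elementary (φ ⇒̇ ψ) = Elementary φ × Elementary ψ
Elementary (∀ˢ φ)  = Elementary φ
Elementary (∃ˢ φ)  = Elementary φ
Elementary (∀ᶜ φ)  = ⊥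
Elementary (∃ᶜ φ)  = ⊥

record Structure (ℓ : Level) : Set (lsuc ℓ) where
  infix 4 _∈_
  field
    Class : Set ℓ
    _∈_   : Class → Class → Set ℓ

module ClassTheory {ℓ : Level} (𝔐 : Structure ℓ) where

  open Structure 𝔐 public

  infix 4 _⊆_

  IsSet : Class → Set ℓ
  IsSet X = ∃[ Y ] X ∈ Y

  _⊆_ : Class → Class → Set ℓ
  X ⊆ Y = ∀ z → z ∈ X → z ∈ Y

  ⟦_⟧ : ∀ {n} → Formula n → Vec Class n → Set ℓ
  ⟦ x ∈̇ y ⟧ ρ = lookup ρ x ∈ lookup ρ y
  ⟦ x ≡̇ y ⟧ ρ = lookup ρ x ≡ lookup ρ y
  ⟦ ¬̇ φ ⟧   ρ = ¬ ⟦ φ ⟧ ρ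
  ⟦ φ ∧̇ ψ ⟧ ρ = ⟦ φ ⟧ ρ × ⟦ ψ ⟧ ρ
  ⟦ φ ∨̇ ψ ⟧ ρ = ⟦ φ ⟧ ρ ⊎ ⟦ ψ ⟧ ρ
  ⟦ φ ⇒̇ ψ ⟧ ρ = ⟦ φ ⟧ ρ → ⟦ ψ ⟧ ρ
  ⟦ ∀ˢ φ ⟧  ρ = ∀ x → IsSet x → ⟦ φ ⟧ (x ∷ ρ)
  ⟦ ∃ˢ φ ⟧  ρ = ∃[ x ] IsSet x × ⟦ φ ⟧ (x ∷ ρ)
  ⟦ ∀ᶜ φ ⟧  ρ = ∀ X → ⟦ φ ⟧ (X ∷ ρ)
  ⟦ ∃ᶜ φ ⟧  ρ = ∃[ X ] ⟦ φ ⟧ (X ∷ ρ)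

  -- p = {x , y}.  As z ranges over all classes, this forces x and y to
  -- be sets.

  IsPair : Class → Class → Class → Set ℓ
  IsPair p x y = ∀ z → z ∈ p ⇔ (z ≡ x ⊎ z ≡ y)

  -- p is the Kuratowski pair {{x} , {x , y}}.

  IsOrderedPair : Class → Class → Class → Set ℓ
  IsOrderedPair p x y =
    ∃[ a ] ∃[ b ] IsPair a x x × IsPair b x y × IsPair p a b

  -- ⟨ R ⟩ x y says that the ordered pair (x , y) belongs to R.

  ⟨_⟩ : Class → Class → Class → Set ℓ
  ⟨ R ⟩ x y = ∃[ p ] IsOrderedPair p x y × p ∈ R

  SingleValued : Class → Set ℓ
  SingleValued F = ∀ x y y′ → ⟨ F ⟩ x y → ⟨ F ⟩ x y′ → y ≡ y′

  -- Gödel's axioms, with class formation given as the schema of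
  -- elementary comprehension.  Replacement is for partial functions, so
  -- it includes separation.  The choice axiom is global choice.

  record GBC : Set ℓ where
    field
      extensionality : ∀ X Y → (∀ z → z ∈ X ⇔ z ∈ Y) → X ≡ Y
      comprehension  : ∀ {n} (φ : Formula (suc n)) → Elementary φ →
                       (ρ : Vec Class n) →
                       ∃[ A ] ∀ x → x ∈ A ⇔ (IsSet x × ⟦ φ ⟧ (x ∷ ρ))
      pairing        : ∀ x y → IsSet x → IsSet y →
                       ∃[ p ] IsSet p × IsPair p x y
      union          : ∀ x → IsSet x →
                       ∃[ u ] IsSet u × (∀ z → z ∈ u ⇔ (∃[ y ] z ∈ y × y ∈ x))
      powerset       : ∀ x → IsSet x →
                       ∃[ p ] IsSet p × (∀ z → z ∈ p ⇔ (IsSet z × z ⊆ x))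
      infinity       : ∃[ a ] IsSet a
                       × (∃[ e ] e ∈ a × (∀ z → ¬ z ∈ e))
                       × (∀ x → x ∈ a →
                            ∃[ s ] s ∈ a × (∀ z → z ∈ s ⇔ (z ∈ x ⊎ z ≡ x)))
      replacement    : ∀ F → SingleValued F → ∀ a → IsSet a →
                       ∃[ b ] IsSet b
                       × (∀ y → y ∈ b ⇔ (∃[ x ] x ∈ a × ⟨ F ⟩ x y))
      foundation     : ∀ A → (∃[ x ] x ∈ A) →
                       ∃[ x ] x ∈ A × (∀ y → y ∈ x → ¬ y ∈ A)
      choice         : ∃[ F ] SingleValued F
                       × (∀ x → IsSet x → (∃[ z ] z ∈ x) →
                            ∃[ y ] y ∈ x × ⟨ F ⟩ x y)

    𝕍 : Class
    𝕍 = proj₁ (comprehension (zero ≡̇ zero) _ [])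

  -- Definability is by an arbitrary formula, possibly with class
  -- quantifiers, and with class parameters.

  Definable : U.Pred Class ℓ → Set ℓ
  Definable I = ∃[ n ] Σ (Formula (suc n)) λ φ → Σ (Vec Class n) λ ρ →
                ∀ Y → I Y ⇔ ⟦ φ ⟧ (Y ∷ ρ)

  record Ideal (X : Class) (I : U.Pred Class ℓ) : Set ℓ where
    field
      definable  : Definable I
      subclasses : ∀ Y → I Y → Y ⊆ X
      ∪-closed   : ∀ Y₁ Y₂ Z → I Y₁ → I Y₂ →
                   (∀ z → z ∈ Z ⇔ (z ∈ Y₁ ⊎ z ∈ Y₂)) → I Z
      ⊆-closed   : ∀ Y Z → I Y → Z ⊆ Y → I Z
      proper     : ¬ I X

  -- ⟨ R ⟩ x y is read as x ≼ y.

  record Preordering (X R : Class) : Set ℓ where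
    field
      onX         : ∀ p → p ∈ R →
                    ∃[ x ] ∃[ y ] x ∈ X × y ∈ X × IsOrderedPair p x y
      reflexive   : ∀ x → x ∈ X → ⟨ R ⟩ x x
      transitive  : ∀ x y z → ⟨ R ⟩ x y → ⟨ R ⟩ y z → ⟨ R ⟩ x z
      total       : ∀ x y → x ∈ X → y ∈ X → ⟨ R ⟩ x y ⊎ ⟨ R ⟩ y x
      noLast      : ¬ (∃[ x ] x ∈ X × (∀ y → y ∈ X → ⟨ R ⟩ y x))

  Seg : Class → Class → U.Pred Class ℓ
  Seg X R Y = Y ⊆ X × (∃[ x ] x ∈ X × (∀ y → y ∈ Y → ⟨ R ⟩ y x))

  Accessible : Class → U.Pred Class ℓ → Set ℓ
  Accessible X I = ∃[ R ] Preordering X R × Seg X R U.⊆ I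

  AccessIdeal : Class → U.Pred Class ℓ → Set ℓ
  AccessIdeal X I = Ideal X I × Accessible X I

  MinimalAccessIdeal : Class → U.Pred Class ℓ → Set (lsuc ℓ)
  MinimalAccessIdeal X I =
    AccessIdeal X I ×
    (∀ (J : U.Pred Class ℓ) → Ideal X J → J U.⊂ I → ¬ Accessible X J)

-- The relation rank x ≤ rank y is the greatest simulation of ∈, so it has an
-- elementary definition, and its initial segments are sets.  Hence the sets
-- form an access ideal; it is minimal because for a smaller one some set is
-- cofinal in a preordering whose initial segments are sets, so 𝕍 would be a
-- set by replacement.
--
-- Conversely let Seg(≼) ⊆ I for a minimal I, and suppose that some set a is
-- not in I; then a is cofinal.  Read every set v as a relation, with value
-- F {c ∈ a : (b , c) ∈ v} at b ∈ a for a global choice function F.  König's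
-- diagonal argument gives b such that the values at b of the v ≼ b are
-- cofinal.  Reordering {v : v ≼ b} by these values yields a preordering whose
-- bounded classes are ≼-bounded, but for which {v : v ≼ b}, which is in I, is
-- cofinal: this contradicts minimality.

module Submission where

open import Defs
open import Axiom.ExcludedMiddle using (ExcludedMiddle)
open import Data.Empty using (⊥)
open import Data.Fin using (Fin; zero; suc)
open import Data.Nat using (ℕ; suc)
open import Data.Product using (∃-syntax; _×_; _,_; proj₁; proj₂)
open import Data.Sum using (_⊎_; inj₁; inj₂; [_,_]′)
import Data.Sum as Sum
open import Data.Vec using (Vec; []; _∷_; lookup)
open import Function using (_∘_; id)
open import Function.Bundles using (_⇔_; mk⇔; Equivalence)
open import Level using (Level)
open import Relation.Binary.PropositionalEquality
  using (_≡_; refl; sym; trans; subst)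
open import Relation.Nullary using (¬_; Dec; yes; no; contradiction)
open import Relation.Nullary.Decidable using (decidable-stable)
open import Relation.Unary using (Pred; _≐_)
import Relation.Unary as U

open Equivalence using (to; from)

pattern v0 = zero
pattern v1 = suc v0
pattern v2 = suc v1
pattern v3 = suc v2
pattern v4 = suc v3
pattern v5 = suc v4
pattern v6 = suc v5
pattern v7 = suc v6

module Development {ℓ : Level} (em : ExcludedMiddle ℓ) (𝔐 : Structure ℓ)
                   (gbc : ClassTheory.GBC 𝔐) where

  open ClassTheory 𝔐
  open GBC gbc

  dne : {P : Set ℓ} → ¬ ¬ P → P
  dne = decidable-stable em

  ¬∀⇒∃¬ : {P Q : Pred Class ℓ} → ¬ (∀ x → P x → Q x) → ∃[ x ] P x × ¬ Q x
  ¬∀⇒∃¬ ¬∀ = dne λ ¬∃ → ¬∀ λ x Px → dne λ ¬Qx → ¬∃ (x , Px , ¬Qx)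

  -- Elementary predicates

  -- An Agda predicate on environments together with an elementary formula that defines it.
  -- Comprehension can then be applied to predicates built by the combinators below, without
  -- handling their formulas.
  record Elem {n : ℕ} (P : Pred (Vec Class n) ℓ) : Set ℓ where
    field
      formula    : Formula n
      elementary : Elementary formula
      correct    : ∀ ρ → ⟦ formula ⟧ ρ ⇔ P ρ

  open Elem

  infix  8 _∈ᵉ_ _≡ᵉ_ _⊆ᵉ_
  infix  7 ¬ᵉ_
  infixr 6 _∧ᵉ_
  infixr 5 _∨ᵉ_
  infixr 4 _⇒ᵉ_ ∀ᵉ_ ∃ᵉ_

  private variable
    n : ℕ
    P Q : Pred (Vec Class n) ℓ

  equiv : Elem P → (∀ ρ → P ρ ⇔ Q ρ) → Elem Q
  equiv E P⇔Q = record
    { formula    = formula E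
    ; elementary = elementary E
    ; correct    = λ ρ → mk⇔ (to (P⇔Q ρ) ∘ to (correct E ρ))
                             (from (correct E ρ) ∘ from (P⇔Q ρ))
    }

  opaque
    _∈ᵉ_ : (i j : Fin n) → Elem (λ ρ → lookup ρ i ∈ lookup ρ j)
    i ∈ᵉ j = record { formula = i ∈̇ j ; correct = λ _ → mk⇔ id id }

    _≡ᵉ_ : (i j : Fin n) → Elem (λ ρ → lookup ρ i ≡ lookup ρ j)
    i ≡ᵉ j = record { formula = i ≡̇ j ; correct = λ _ → mk⇔ id id }

    ¬ᵉ_ : Elem P → Elem (λ ρ → ¬ P ρ)
    ¬ᵉ E = record
      { formula    = ¬̇ formula E
      ; elementary = elementary E
      ; correct    = λ ρ → mk⇔ (_∘ from (correct E ρ)) (_∘ to (correct E ρ))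
      }

    _∧ᵉ_ : Elem P → Elem Q → Elem (λ ρ → P ρ × Q ρ)
    D ∧ᵉ E = record
      { formula    = formula D ∧̇ formula E
      ; elementary = elementary D , elementary E
      ; correct    = λ ρ → mk⇔
          (λ (p , q) → to (correct D ρ) p , to (correct E ρ) q)
          (λ (p , q) → from (correct D ρ) p , from (correct E ρ) q)
      }

    _∨ᵉ_ : Elem P → Elem Q → Elem (λ ρ → P ρ ⊎ Q ρ)
    D ∨ᵉ E = record
      { formula    = formula D ∨̇ formula E
      ; elementary = elementary D , elementary E
      ; correct    = λ ρ → mk⇔
          (Sum.map (to (correct D ρ)) (to (correct E ρ)))
          (Sum.map (from (correct D ρ)) (from (correct E ρ)))
      }

    _⇒ᵉ_ : Elem P → Elem Q → Elem (λ ρ → P ρ → Q ρ)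
    D ⇒ᵉ E = record
      { formula    = formula D ⇒̇ formula E
      ; elementary = elementary D , elementary E
      ; correct    = λ ρ → mk⇔
          (λ f → to (correct E ρ) ∘ f ∘ from (correct D ρ))
          (λ f → from (correct E ρ) ∘ f ∘ to (correct D ρ))
      }

    ∀ᵉ_ : Elem P → Elem (λ ρ → ∀ x → IsSet x → P (x ∷ ρ))
    ∀ᵉ E = record
      { formula    = ∀ˢ formula E
      ; elementary = elementary E
      ; correct    = λ ρ → mk⇔
          (λ f x s → to (correct E (x ∷ ρ)) (f x s))
          (λ f x s → from (correct E (x ∷ ρ)) (f x s))
      }

    ∃ᵉ_ : Elem P → Elem (λ ρ → ∃[ x ] IsSet x × P (x ∷ ρ))
    ∃ᵉ E = record
      { formula    = ∃ˢ formula E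
      ; elementary = elementary E
      ; correct    = λ ρ → mk⇔
          (λ (x , s , p) → x , s , to (correct E (x ∷ ρ)) p)
          (λ (x , s , p) → x , s , from (correct E (x ∷ ρ)) p)
      }

    -- Whatever belongs to a class is a set, so a quantifier bounded by membership is a case of the
    -- quantifier over sets.
    ∀∈ᵉ : (i : Fin n) → Elem P → Elem (λ ρ → ∀ x → x ∈ lookup ρ i → P (x ∷ ρ))
    ∀∈ᵉ i E = equiv (∀ᵉ v0 ∈ᵉ suc i ⇒ᵉ E) λ ρ → mk⇔
      (λ f x x∈ → f x (_ , x∈) x∈)
      (λ f x _ → f x)

    ∃∈ᵉ : (i : Fin n) → Elem P → Elem (λ ρ → ∃[ x ] x ∈ lookup ρ i × P (x ∷ ρ))
    ∃∈ᵉ i E = equiv (∃ᵉ v0 ∈ᵉ suc i ∧ᵉ E) λ ρ → mk⇔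
      (λ (x , _ , x∈ , p) → x , x∈ , p)
      (λ (x , x∈ , p) → x , (_ , x∈) , x∈ , p)

    _⊆ᵉ_ : (i j : Fin n) → Elem (λ ρ → lookup ρ i ⊆ lookup ρ j)
    i ⊆ᵉ j = ∀∈ᵉ i (v0 ∈ᵉ suc j)

    -- `IsPair` quantifies over all classes and is not elementary as it stands. Bounding the
    -- quantifier by `p` and asserting `x ∈ p` and `y ∈ p` separately gives an equivalent elementary
    -- form.
    pairᵉ : (p x y : Fin n) →
            Elem (λ ρ → IsPair (lookup ρ p) (lookup ρ x) (lookup ρ y))
    pairᵉ p x y =
      equiv (x ∈ᵉ p ∧ᵉ y ∈ᵉ p ∧ᵉ ∀∈ᵉ p (v0 ≡ᵉ suc x ∨ᵉ v0 ≡ᵉ suc y)) λ ρ → mk⇔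
        (λ (x∈ , y∈ , h) z → mk⇔ (h z) λ { (inj₁ refl) → x∈ ; (inj₂ refl) → y∈ })
        (λ h → from (h _) (inj₁ refl) , from (h _) (inj₂ refl) , λ z → to (h z))

    opairᵉ : (p x y : Fin n) →
             Elem (λ ρ → IsOrderedPair (lookup ρ p) (lookup ρ x) (lookup ρ y))
    opairᵉ p x y =
      -- The two inner pairs are members of `p`, so the class quantifiers over them can be bounded
      -- by `p`.
      equiv (∃∈ᵉ p (∃∈ᵉ (suc p)
              (pairᵉ v1 (suc (suc x)) (suc (suc x)) ∧ᵉ
               pairᵉ v0 (suc (suc x)) (suc (suc y)) ∧ᵉ
               pairᵉ (suc (suc p)) v1 v0))) λ ρ → mk⇔
        (λ (a , _ , b , _ , h) → a , b , h)
        (λ (a , b , ha , hb , hp) →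
           a , from (hp a) (inj₁ refl) , b , from (hp b) (inj₂ refl) , ha , hb , hp)

    relᵉ : (r x y : Fin n) →
           Elem (λ ρ → ⟨ lookup ρ r ⟩ (lookup ρ x) (lookup ρ y))
    relᵉ r x y =
      equiv (∃∈ᵉ r (opairᵉ v0 (suc x) (suc y))) λ ρ → mk⇔
        (λ (p , p∈ , o) → p , o , p∈)
        (λ (p , o , p∈) → p , p∈ , o)

  opaque
    comprehend : (ρ : Vec Class n) → Elem P →
                 ∃[ A ] ∀ x → x ∈ A ⇔ (IsSet x × P (x ∷ ρ))
    comprehend ρ E with A , h ← comprehension (formula E) (elementary E) ρ =
      A , λ x → mk⇔
        (λ x∈ → let s , p = to (h x) x∈ in s , to (correct E (x ∷ ρ)) p)
        (λ (s , p) → from (h x) (s , from (correct E (x ∷ ρ)) p))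

    -- The counterexamples form a class because the predicate is elementary; foundation gives it an
    -- ∈-minimal member, which contradicts the induction step.
    ∈-induction : (ρ : Vec Class n) → Elem P →
                  (∀ x → IsSet x → (∀ y → y ∈ x → P (y ∷ ρ)) → P (x ∷ ρ)) →
                  ∀ x → IsSet x → P (x ∷ ρ)
    ∈-induction ρ E step x xˢ = dne λ ¬Px →
      let A , h            = comprehend ρ (¬ᵉ E)
          m , m∈A , minimal = foundation A (x , from (h x) (xˢ , ¬Px))
          mˢ , ¬Pm         = to (h m) m∈A
      in ¬Pm (step m mˢ λ y y∈m → dne λ ¬Py →
           minimal y y∈m (from (h y) ((_ , y∈m) , ¬Py)))

  -- Pairs and relations

  pair-members : ∀ {p x y} → IsOrderedPair p x y → IsSet x × IsSet y
  pair-members (a , b , ha , hb , _) =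
    (a , from (ha _) (inj₁ refl)) , (b , from (hb _) (inj₂ refl))

  ⟨⟩-sets : ∀ {R x y} → ⟨ R ⟩ x y → IsSet x × IsSet y
  ⟨⟩-sets (_ , o , _) = pair-members o

  orderedPair : ∀ {x y} → IsSet x → IsSet y →
                ∃[ p ] IsSet p × IsOrderedPair p x y
  orderedPair {x} {y} xˢ yˢ =
    let a , aˢ , ha = pairing x x xˢ xˢ
        b , bˢ , hb = pairing x y xˢ yˢ
        p , pˢ , hp = pairing a b aˢ bˢ
    in p , pˢ , a , b , ha , hb , hp

  orderedPair-first : ∀ {p x y x′ y′} →
    IsOrderedPair p x y → IsOrderedPair p x′ y′ → x ≡ x′
  orderedPair-first {x′ = x′} (a , _ , ha , _ , hp) (_ , _ , ha′ , hb′ , hp′)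
    with to (hp′ a) (from (hp a) (inj₁ refl))
  ... | inj₁ refl = sym ([ id , id ]′ (to (ha x′) (from (ha′ x′) (inj₁ refl))))
  ... | inj₂ refl = sym ([ id , id ]′ (to (ha x′) (from (hb′ x′) (inj₁ refl))))

  orderedPair-second : ∀ {p x y x′ y′} →
    IsOrderedPair p x y → IsOrderedPair p x′ y′ → y ≡ x′ ⊎ y ≡ y′
  orderedPair-second {y = y} (_ , b , _ , hb , hp) (_ , _ , ha′ , hb′ , hp′)
    with to (hp′ b) (from (hp b) (inj₂ refl))
  ... | inj₁ refl = inj₁ ([ id , id ]′ (to (ha′ y) (from (hb y) (inj₂ refl))))
  ... | inj₂ refl = to (hb′ y) (from (hb y) (inj₂ refl))

  orderedPair-injective : ∀ {p x y x′ y′} →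
    IsOrderedPair p x y → IsOrderedPair p x′ y′ → x ≡ x′ × y ≡ y′
  orderedPair-injective o o′ with orderedPair-first o o′
  ... | refl with orderedPair-second o o′ | orderedPair-second o′ o
  ... | inj₂ eq   | _        = refl , eq
  ... | inj₁ _    | inj₂ eq  = refl , sym eq
  -- In this case both second components equal the common first component.
  ... | inj₁ refl | inj₁ eq  = refl , sym eq

  -- The defining predicate is evaluated at y ∷ x ∷ p ∷ ρ, where p is the
  -- pair (x , y) itself, which it must ignore.

  opaque
    relation : (ρ : Vec Class n) (T : Class → Class → Set ℓ) → Elem P →
               (∀ p x y → P (y ∷ x ∷ p ∷ ρ) ≡ T x y) →
               ∃[ R ] (∀ p → p ∈ R → ∃[ x ] ∃[ y ] IsOrderedPair p x y)
                      × (∀ x y → ⟨ R ⟩ x y ⇔ (IsSet x × IsSet y × T x y))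
    relation ρ T E P≡T =
      let R , h = comprehend ρ (∃ᵉ ∃ᵉ opairᵉ v2 v1 v0 ∧ᵉ E)
      in R
       , (λ p p∈ → let _ , x , _ , y , _ , o , _ = to (h p) p∈ in x , y , o)
       , λ x y → mk⇔
           (λ (p , o , p∈) →
              let _ , x′ , xˢ , y′ , yˢ , o′ , t = to (h p) p∈
              in unpack o o′ xˢ yˢ (subst id (P≡T p x′ y′) t))
           (λ (xˢ , yˢ , t) →
              let p , pˢ , o = orderedPair xˢ yˢ
              in p , o , from (h p)
                   (pˢ , x , xˢ , y , yˢ , o , subst id (sym (P≡T p x y)) t))
      where
      unpack : ∀ {p x y x′ y′} → IsOrderedPair p x y → IsOrderedPair p x′ y′ →
               IsSet x′ → IsSet y′ → T x′ y′ → IsSet x × IsSet y × T x y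
      unpack o o′ xˢ yˢ t with refl , refl ← orderedPair-injective o o′ =
        xˢ , yˢ , t

  -- Sets

  opaque
    -- Separation is obtained from replacement: `Z` is the image of `Y` under the identity function
    -- restricted to `Z`.
    ⊆-isSet : ∀ {Y Z} → IsSet Y → Z ⊆ Y → IsSet Z
    ⊆-isSet {Y} {Z} Yˢ Z⊆Y =
      let F , _ , h = relation (Z ∷ []) (λ x y → x ∈ Z × x ≡ y)
                        (v1 ∈ᵉ v3 ∧ᵉ v1 ≡ᵉ v0) (λ _ _ _ → refl)
          b , bˢ , hb = replacement F
            (λ x y y′ r r′ → trans (sym (proj₂ (proj₂ (proj₂ (to (h x y) r)))))
                                   (proj₂ (proj₂ (proj₂ (to (h x y′) r′)))))
            Y Yˢ
      in subst IsSet
           (extensionality b Z λ z → mk⇔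
             (λ z∈b → let x , _ , r = to (hb z) z∈b
                          _ , _ , x∈Z , x≡z = to (h x z) r
                      in subst (_∈ Z) x≡z x∈Z)
             (λ z∈Z → from (hb z)
                (z , Z⊆Y z z∈Z , from (h z z) ((_ , z∈Z) , (_ , z∈Z) , z∈Z , refl))))
           bˢ

    -- A Kuratowski pair of members of `t` is a set of subsets of `t`, so `S` is contained in the
    -- double power set of `t`.
    graph-isSet : ∀ {t S} → IsSet t →
      (∀ p → p ∈ S → ∃[ x ] ∃[ y ] x ∈ t × y ∈ t × IsOrderedPair p x y) → IsSet S
    graph-isSet {t} tˢ h =
      let q , qˢ , hq = powerset t tˢ
          r , rˢ , hr = powerset q qˢ
          both : ∀ {a x y} → x ∈ t → y ∈ t → IsPair a x y → a ⊆ t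
          both = λ x∈t y∈t ha z z∈a →
            [ (λ { refl → x∈t }) , (λ { refl → y∈t }) ]′ (to (ha z) z∈a)
      in ⊆-isSet rˢ λ p p∈S →
           let x , y , x∈t , y∈t , a , b , ha , hb , hp = h p p∈S
           in from (hr p) ((_ , p∈S) , λ z z∈p → from (hq z)
                ((_ , z∈p) , [ (λ { refl → both x∈t x∈t ha })
                             , (λ { refl → both x∈t y∈t hb }) ]′ (to (hp z) z∈p)))

  isSet⇒∈𝕍 : ∀ {x} → IsSet x → x ∈ 𝕍
  isSet⇒∈𝕍 xˢ = from (proj₂ (comprehension (zero ≡̇ zero) _ []) _) (xˢ , refl)

  -- If `𝕍` were a set, then `𝕍 ∈ 𝕍`, and foundation would fail for the singleton of `𝕍`.
  𝕍-proper : ¬ IsSet 𝕍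
  𝕍-proper 𝕍ˢ =
    let p , _ , hp = pairing 𝕍 𝕍 𝕍ˢ 𝕍ˢ
        m , m∈p , minimal = foundation p (𝕍 , from (hp 𝕍) (inj₁ refl))
        m≡𝕍 = [ id , id ]′ (to (hp m) m∈p)
    in minimal 𝕍 (subst (𝕍 ∈_) (sym m≡𝕍) (isSet⇒∈𝕍 𝕍ˢ)) (from (hp 𝕍) (inj₁ refl))

  -- Initial segments and their unions

  opaque
    initial : Class → Class → Class
    initial R y = proj₁ (comprehend (R ∷ y ∷ []) (relᵉ v1 v0 v2))

    ∈-initial : ∀ R x y → x ∈ initial R y ⇔ ⟨ R ⟩ x y
    ∈-initial R x y with h ← proj₂ (comprehend (R ∷ y ∷ []) (relᵉ v1 v0 v2)) x =
      mk⇔ (proj₂ ∘ to h) (λ r → from h (proj₁ (⟨⟩-sets r) , r))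

    -- Replacement along the function taking `y` to its initial segment, followed by union. That
    -- function is defined at every `y ∈ a` because these segments are assumed to be sets.
    initial-union : ∀ R a → IsSet a → (∀ y → y ∈ a → IsSet (initial R y)) →
      ∃[ u ] IsSet u × (∀ x → x ∈ u ⇔ (∃[ y ] y ∈ a × ⟨ R ⟩ x y))
    initial-union R a aˢ hyp =
      let F , _ , h = relation (R ∷ [])
            (λ y w → (∀ x → x ∈ w → ⟨ R ⟩ x y)
                     × (∀ x → IsSet x → ⟨ R ⟩ x y → x ∈ w))
            (∀∈ᵉ v0 (relᵉ v4 v0 v2) ∧ᵉ (∀ᵉ relᵉ v4 v0 v2 ⇒ᵉ v0 ∈ᵉ v1))
            (λ _ _ _ → refl)
          b , bˢ , hb = replacement F
            (λ y w w′ r r′ →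
               let _ , _ , f , g = to (h y w) r
                   _ , _ , f′ , g′ = to (h y w′) r′
               in extensionality w w′ λ z → mk⇔
                    (λ z∈ → g′ z (_ , z∈) (f z z∈))
                    (λ z∈ → g z (_ , z∈) (f′ z z∈)))
            a aˢ
          u , uˢ , hu = union b bˢ
      in u , uˢ , λ x → mk⇔
           (λ x∈u → let w , x∈w , w∈b = to (hu x) x∈u
                        y , y∈a , r = to (hb w) w∈b
                        _ , _ , f , _ = to (h y w) r
                    in y , y∈a , f x x∈w)
           (λ (y , y∈a , r) → from (hu x)
              (initial R y , from (∈-initial R x y) r
              , from (hb _) (y , y∈a , from (h y _)
                  ((_ , y∈a) , hyp y y∈a
                  , (λ z → to (∈-initial R z y)) , (λ z _ → from (∈-initial R z y))))))

  -- Transitive sets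

  Transitive : Class → Set ℓ
  Transitive t = ∀ z → z ∈ t → z ⊆ t

  opaque
    transitiveᵉ : (i : Fin n) → Elem (λ ρ → Transitive (lookup ρ i))
    transitiveᵉ i = ∀∈ᵉ i (v0 ⊆ᵉ suc i)

    transitiveSet : ∀ x → IsSet x → ∃[ t ] IsSet t × Transitive t × x ∈ t
    transitiveSet =
      ∈-induction [] (∃ᵉ transitiveᵉ v0 ∧ᵉ v1 ∈ᵉ v0) λ x xˢ ih →
        -- ⟨ H ⟩ z y says that z is in the transitive closure of {y}.
        let H , _ , h = relation []
              (λ z y → ∀ t → IsSet t → Transitive t → y ∈ t → z ∈ t)
              (∀ᵉ transitiveᵉ v0 ⇒ᵉ v1 ∈ᵉ v0 ⇒ᵉ v2 ∈ᵉ v0) (λ _ _ _ → refl)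
            u , uˢ , hu = initial-union H x xˢ λ y y∈x →
              let t , tˢ , tt , y∈t = ih y y∈x
              in ⊆-isSet tˢ λ z z∈ →
                   proj₂ (proj₂ (to (h z y) (to (∈-initial H z y) z∈))) t tˢ tt y∈t
            x⊆u : x ⊆ u
            x⊆u = λ y y∈x → from (hu y)
              (y , y∈x , from (h y y) ((_ , y∈x) , (_ , y∈x) , λ _ _ _ → id))
            ut : Transitive u
            ut = λ z z∈u w w∈z →
              let y , y∈x , r = to (hu z) z∈u
                  _ , yˢ , k = to (h z y) r
              in from (hu w) (y , y∈x , from (h w y)
                   ((_ , w∈z) , yˢ , λ t tˢ tt y∈t → tt z (k t tˢ tt y∈t) w w∈z))
            -- The union `u` of the closures is transitive and includes `x`; its power set is again
            -- transitive and has `x` as a member.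
            q , qˢ , hq = powerset u uˢ
        in q , qˢ
         , (λ z z∈q w w∈z →
              from (hq w) ((_ , w∈z) , ut w (proj₂ (to (hq z) z∈q) w w∈z)))
         , from (hq x) (xˢ , x⊆u)

  -- The rank preordering

  -- The recursive clause for rank comparison: every member of `x` has rank at most that of some
  -- member of `y`.
  Simulation : Class → Set ℓ
  Simulation S = ∀ x → IsSet x → ∀ y → IsSet y → ⟨ S ⟩ x y →
                 ∀ x′ → x′ ∈ x → ∃[ y′ ] y′ ∈ y × ⟨ S ⟩ x′ y′

  opaque
    simulationᵉ : (i : Fin n) → Elem (λ ρ → Simulation (lookup ρ i))
    simulationᵉ i =
      ∀ᵉ ∀ᵉ relᵉ (suc (suc i)) v1 v0 ⇒ᵉ
        ∀∈ᵉ v1 (∃∈ᵉ v1 (relᵉ (suc (suc (suc (suc i)))) v1 v0))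

  opaque
    -- The greatest simulation is taken as the union of those simulations that are sets, which keeps
    -- its definition free of class quantifiers.
    rankRelation : ∃[ R ]
      (∀ p → p ∈ R → ∃[ x ] ∃[ y ] IsOrderedPair p x y)
      × (∀ x y → ⟨ R ⟩ x y ⇔
           (IsSet x × IsSet y × ∃[ S ] IsSet S × Simulation S × ⟨ S ⟩ x y))
    rankRelation = relation [] _ (∃ᵉ simulationᵉ v0 ∧ᵉ relᵉ v0 v2 v1) λ _ _ _ → refl

  Rank : Class
  Rank = proj₁ rankRelation

  infix 4 _≲_
  _≲_ : Class → Class → Set ℓ
  _≲_ = ⟨ Rank ⟩

  ≲-char : ∀ x y → x ≲ y ⇔
    (IsSet x × IsSet y × ∃[ S ] IsSet S × Simulation S × ⟨ S ⟩ x y)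
  ≲-char = proj₂ (proj₂ rankRelation)

  ≲-elim : ∀ {x y} → x ≲ y → ∀ x′ → x′ ∈ x → ∃[ y′ ] y′ ∈ y × x′ ≲ y′
  ≲-elim {x} {y} r x′ x′∈x =
    let xˢ , yˢ , S , Sˢ , sim , s = to (≲-char x y) r
        y′ , y′∈y , s′ = sim x xˢ y yˢ s x′ x′∈x
    in y′ , y′∈y , from (≲-char x′ y′) ((_ , x′∈x) , (_ , y′∈y) , S , Sˢ , sim , s′)

  -- The witnessing simulation is ≲, unfolded once, on a transitive set
  -- containing x and y.

  ≲-intro : ∀ {x y} → IsSet x → IsSet y →
            (∀ x′ → x′ ∈ x → ∃[ y′ ] y′ ∈ y × x′ ≲ y′) → x ≲ y
  ≲-intro {x} {y} xˢ yˢ below =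
    let q , qˢ , hq = pairing x y xˢ yˢ
        t , tˢ , tt , q∈t = transitiveSet q qˢ
        S , shape , h = relation (t ∷ Rank ∷ [])
          (λ u v → u ∈ t × v ∈ t × (∀ u′ → u′ ∈ u → ∃[ v′ ] v′ ∈ v × u′ ≲ v′))
          (v1 ∈ᵉ v3 ∧ᵉ v0 ∈ᵉ v3 ∧ᵉ ∀∈ᵉ v1 (∃∈ᵉ v1 (relᵉ v6 v1 v0)))
          (λ _ _ _ → refl)
        Sˢ = graph-isSet tˢ λ p p∈S →
          let u , v , o = shape p p∈S
              _ , _ , u∈t , v∈t , _ = to (h u v) (p , o , p∈S)
          in u , v , u∈t , v∈t , o
        sim : Simulation S
        sim = λ u _ v _ s u′ u′∈u →
          let _ , _ , u∈t , v∈t , k = to (h u v) s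
              v′ , v′∈v , r = k u′ u′∈u
          in v′ , v′∈v , from (h u′ v′)
               ((_ , u′∈u) , (_ , v′∈v) , tt u u∈t u′ u′∈u , tt v v∈t v′ v′∈v , ≲-elim r)
    in from (≲-char x y) (xˢ , yˢ , S , Sˢ , sim , from (h x y)
         (xˢ , yˢ , tt q q∈t x (from (hq x) (inj₁ refl))
         , tt q q∈t y (from (hq y) (inj₂ refl)) , below))

  -- If `x ≲ y` fails, some `x′ ∈ x` is below no member of `y`. By induction every member of `y` is
  -- below `x′`, so `y ≲ x`.
  ≲-total : ∀ x → IsSet x → ∀ y → IsSet y → x ≲ y ⊎ y ≲ x
  ≲-total =
    ∈-induction (Rank ∷ []) (∀ᵉ relᵉ v2 v1 v0 ∨ᵉ relᵉ v2 v0 v1) λ x xˢ ih y yˢ →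
      case-em x xˢ ih y yˢ em
    where
    case-em : ∀ x → IsSet x → (∀ x′ → x′ ∈ x → ∀ y → IsSet y → x′ ≲ y ⊎ y ≲ x′) →
              ∀ y → IsSet y → Dec (x ≲ y) → x ≲ y ⊎ y ≲ x
    case-em x xˢ ih y yˢ (yes r) = inj₁ r
    case-em x xˢ ih y yˢ (no ¬r) =
      let x′ , x′∈x , none = ¬∀⇒∃¬ (¬r ∘ ≲-intro xˢ yˢ)
      in inj₂ (≲-intro yˢ xˢ λ y′ y′∈y → x′ , x′∈x ,
           [ (λ r → contradiction (y′ , y′∈y , r) none) , id ]′
             (ih x′ x′∈x y′ (_ , y′∈y)))

  ≲-trans : ∀ x → IsSet x → ∀ y → IsSet y → ∀ z → IsSet z → x ≲ y → y ≲ z → x ≲ z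
  ≲-trans =
    ∈-induction (Rank ∷ [])
      (∀ᵉ ∀ᵉ relᵉ v3 v2 v1 ⇒ᵉ relᵉ v3 v1 v0 ⇒ᵉ relᵉ v3 v2 v0)
      λ x xˢ ih y yˢ z zˢ r s → ≲-intro xˢ zˢ λ x′ x′∈x →
        let y′ , y′∈y , r′ = ≲-elim r x′ x′∈x
            z′ , z′∈z , s′ = ≲-elim s y′ y′∈y
        in z′ , z′∈z , ih x′ x′∈x y′ (_ , y′∈y) z′ (_ , z′∈z) r′ s′

  -- By ∈-induction on `y`: if `x ≲ y`, the members of `x` lie in the union of the initial segments
  -- of the members of `y`. This union is a set, and its power set contains every such `x`.
  initial-≲-isSet : ∀ y → IsSet y → IsSet (initial Rank y)
  initial-≲-isSet y yˢ =
    let w , wˢ , h = bounds y yˢ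
    in ⊆-isSet wˢ λ x x∈ →
         let r = to (∈-initial Rank x y) x∈ in h x (proj₁ (⟨⟩-sets r)) r
    where
    bounds : ∀ y → IsSet y → ∃[ w ] IsSet w × (∀ x → IsSet x → x ≲ y → x ∈ w)
    bounds = ∈-induction (Rank ∷ []) (∃ᵉ ∀ᵉ relᵉ v3 v0 v2 ⇒ᵉ v0 ∈ᵉ v1) λ y yˢ ih →
      let u , uˢ , hu = initial-union Rank y yˢ λ y′ y′∈y →
            let w , wˢ , h = ih y′ y′∈y
            in ⊆-isSet wˢ λ x x∈ →
                 let r = to (∈-initial Rank x y′) x∈ in h x (proj₁ (⟨⟩-sets r)) r
          q , qˢ , hq = powerset u uˢ
      in q , qˢ , λ x xˢ r → from (hq x)
           (xˢ , λ x′ x′∈x → from (hu x′) (≲-elim r x′ x′∈x))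

  ≲-preordering : Preordering 𝕍 Rank
  ≲-preordering = record
    { onX        = λ p p∈ →
        let x , y , o = proj₁ (proj₂ rankRelation) p p∈
            xˢ , yˢ = pair-members o
        in x , y , isSet⇒∈𝕍 xˢ , isSet⇒∈𝕍 yˢ , o
    ; reflexive  = λ x x∈ → [ id , id ]′ (≲-total x (_ , x∈) x (_ , x∈))
    ; transitive = λ x y z r s →
        let xˢ , yˢ = ⟨⟩-sets r ; _ , zˢ = ⟨⟩-sets s in ≲-trans x xˢ y yˢ z zˢ r s
    ; total      = λ x y x∈ y∈ → ≲-total x (_ , x∈) y (_ , y∈)
    -- A last element would make `𝕍` one of its own initial segments, all of which are sets.
    ; noLast     = λ (x , x∈ , last) → 𝕍-proper
        (⊆-isSet (initial-≲-isSet x (_ , x∈)) λ y y∈ →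
          from (∈-initial Rank y x) (last y y∈))
    }

  -- The ideal of sets

  𝕍-ideal : Ideal 𝕍 (_∈ 𝕍)
  𝕍-ideal = record
    { definable  = 1 , zero ∈̇ suc zero , 𝕍 ∷ [] , λ _ → mk⇔ id id
    ; subclasses = λ _ _ z z∈ → isSet⇒∈𝕍 (_ , z∈)
    ; ∪-closed   = λ Y₁ Y₂ Z Y₁∈ Y₂∈ hZ →
        let p , pˢ , hp = pairing Y₁ Y₂ (_ , Y₁∈) (_ , Y₂∈)
            u , uˢ , hu = union p pˢ
        in isSet⇒∈𝕍 (⊆-isSet uˢ λ z z∈ → from (hu z)
             ([ (λ z∈₁ → Y₁ , z∈₁ , from (hp Y₁) (inj₁ refl))
              , (λ z∈₂ → Y₂ , z∈₂ , from (hp Y₂) (inj₂ refl)) ]′ (to (hZ z) z∈)))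
    ; ⊆-closed   = λ Y Z Y∈ Z⊆Y → isSet⇒∈𝕍 (⊆-isSet (_ , Y∈) Z⊆Y)
    ; proper     = λ 𝕍∈𝕍 → 𝕍-proper (_ , 𝕍∈𝕍)
    }

  𝕍-accessible : Accessible 𝕍 (_∈ 𝕍)
  𝕍-accessible = Rank , ≲-preordering , λ (_ , x , x∈ , bound) →
    isSet⇒∈𝕍 (⊆-isSet (initial-≲-isSet x (_ , x∈)) λ y y∈ →
      from (∈-initial Rank y x) (bound y y∈))

  initial∈Seg : ∀ R {y} → y ∈ 𝕍 → Seg 𝕍 R (initial R y)
  initial∈Seg R {y} y∈ =
    (λ _ z∈ → isSet⇒∈𝕍 (_ , z∈)) , y , y∈ , λ z → to (∈-initial R z y)

  -- Bounded classes of a preordering of `𝕍`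

  module _ {R : Class} (pre : Preordering 𝕍 R) where

    open Preordering pre

    seg-cofinal : ∀ {Y} → ¬ Seg 𝕍 R Y → ∀ x → x ∈ 𝕍 →
                  ∃[ y ] y ∈ Y × y ∈ 𝕍 × ¬ ⟨ R ⟩ y x
    seg-cofinal ¬seg x x∈ =
      let y , y∈Y , ¬r = ¬∀⇒∃¬ λ bound →
            ¬seg ((λ _ z∈ → isSet⇒∈𝕍 (_ , z∈)) , x , x∈ , bound)
      in y , y∈Y , isSet⇒∈𝕍 (_ , y∈Y) , ¬r

    ¬≼⇒≽ : ∀ {x y} → x ∈ 𝕍 → y ∈ 𝕍 → ¬ ⟨ R ⟩ y x → ⟨ R ⟩ x y
    ¬≼⇒≽ x∈ y∈ ¬r = [ id , (λ r → contradiction r ¬r) ]′ (total _ _ x∈ y∈)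

    upperBound : ∀ x y → x ∈ 𝕍 → y ∈ 𝕍 → ∃[ z ] z ∈ 𝕍 × ⟨ R ⟩ x z × ⟨ R ⟩ y z
    upperBound x y x∈ y∈ with total x y x∈ y∈
    ... | inj₁ r = y , y∈ , r , reflexive y y∈
    ... | inj₂ r = x , x∈ , reflexive x x∈ , r

    -- Properness holds because a bound for `𝕍` would be a last element. The bounded classes of a
    -- preordering thus form an access ideal that can be tested against minimality.
    seg-ideal : Ideal 𝕍 (Seg 𝕍 R)
    seg-ideal = record
      { definable  = 2 , formula E , 𝕍 ∷ R ∷ [] , λ Y →
          mk⇔ (from (correct E _)) (to (correct E _))
      ; subclasses = λ _ → proj₁
      ; ∪-closed   = λ { Y₁ Y₂ Z (⊆₁ , x₁ , x₁∈ , b₁) (⊆₂ , x₂ , x₂∈ , b₂) hZ →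
          let m , m∈ , r₁ , r₂ = upperBound x₁ x₂ x₁∈ x₂∈
          in (λ z z∈ → isSet⇒∈𝕍 (_ , z∈)) , m , m∈ , λ z z∈ →
               [ (λ z∈₁ → transitive z x₁ m (b₁ z z∈₁) r₁)
               , (λ z∈₂ → transitive z x₂ m (b₂ z z∈₂) r₂) ]′ (to (hZ z) z∈) }
      ; ⊆-closed   = λ { Y Z (Y⊆ , x , x∈ , b) Z⊆Y →
          (λ z z∈ → Y⊆ z (Z⊆Y z z∈)) , x , x∈ , λ z z∈ → b z (Z⊆Y z z∈) }
      ; proper     = λ (_ , last) → noLast last
      }
      where
      E : Elem (λ ρ → Seg (lookup ρ v1) (lookup ρ v2) (lookup ρ v0))
      E = v0 ⊆ᵉ v1 ∧ᵉ ∃∈ᵉ v1 (∀∈ᵉ v1 (relᵉ v4 v0 v1))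

  𝕍-minimal : MinimalAccessIdeal 𝕍 (_∈ 𝕍)
  𝕍-minimal = (𝕍-ideal , 𝕍-accessible) , minimal
    where
    minimal : (J : Pred Class ℓ) → Ideal 𝕍 J → J U.⊂ (_∈ 𝕍) → ¬ Accessible 𝕍 J
    minimal J _ (J⊆𝕍 , 𝕍⊈J) (R , pre , seg⊆J) = 𝕍⊈J λ {a} a∈ → dne λ ¬Ja →
      -- Initial segments are bounded, hence lie in `J` and are sets. Being outside `J`, the set `a`
      -- is cofinal, so the segments of its members cover `𝕍`.
      let u , uˢ , hu = initial-union R a (_ , a∈) λ y y∈a →
            _ , J⊆𝕍 (seg⊆J (initial∈Seg R (isSet⇒∈𝕍 (_ , y∈a))))
      in 𝕍-proper (⊆-isSet uˢ λ x x∈ →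
           let y , y∈a , y∈ , ¬r = seg-cofinal pre (¬Ja ∘ seg⊆J) x x∈
           in from (hu x) (y , y∈a , ¬≼⇒≽ pre x∈ y∈ ¬r))

  -- Refining a preordering

  -- The partial function `E` sends points below `b` to cofinally many values. Ordering by values
  -- makes the bounded class `initial R b` cofinal, so the new ideal of bounded classes is strictly
  -- smaller.
  module Refinement {R : Class} (pre : Preordering 𝕍 R)
    {E : Class} (E-functional : SingleValued E)
    {b : Class} (b∈𝕍 : b ∈ 𝕍)
    (E-domain : ∀ y u → ⟨ E ⟩ y u → ⟨ R ⟩ y b)
    (E-cofinal : ∀ d → d ∈ 𝕍 → ∃[ y ] ∃[ u ] ⟨ E ⟩ y u × ¬ ⟨ R ⟩ u d)
    where

    open Preordering pre

    -- G is E extended by the identity, and y comes before z in R′ iff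
    -- G(y) ≼ G(z).  Since y ≼ max (b , G(y)), an R′-bounded class is
    -- R-bounded.

    opaque
      extension : ∃[ G ] (∀ p → p ∈ G → ∃[ x ] ∃[ y ] IsOrderedPair p x y)
        × (∀ y u → ⟨ G ⟩ y u ⇔ (IsSet y × IsSet u ×
             (⟨ E ⟩ y u ⊎ (¬ (∃[ c ] IsSet c × ⟨ E ⟩ y c)) × y ≡ u)))
      extension = relation (E ∷ []) _
        (relᵉ v3 v1 v0 ∨ᵉ (¬ᵉ (∃ᵉ relᵉ v4 v2 v0)) ∧ᵉ v1 ≡ᵉ v0) λ _ _ _ → refl

    G : Class
    G = proj₁ extension

    G-char : ∀ y u → ⟨ G ⟩ y u ⇔ (IsSet y × IsSet u ×
      (⟨ E ⟩ y u ⊎ (¬ (∃[ c ] IsSet c × ⟨ E ⟩ y c)) × y ≡ u))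
    G-char = proj₂ (proj₂ extension)

    opaque
      pullback : ∃[ R′ ] (∀ p → p ∈ R′ → ∃[ x ] ∃[ y ] IsOrderedPair p x y)
        × (∀ y z → ⟨ R′ ⟩ y z ⇔ (IsSet y × IsSet z ×
             (∃[ u ] IsSet u × ∃[ v ] IsSet v ×
               ⟨ G ⟩ y u × ⟨ G ⟩ z v × ⟨ R ⟩ u v)))
      pullback = relation (G ∷ R ∷ []) _
        (∃ᵉ ∃ᵉ relᵉ v5 v3 v1 ∧ᵉ relᵉ v5 v2 v0 ∧ᵉ relᵉ v6 v1 v0) λ _ _ _ → refl

    R′ : Class
    R′ = proj₁ pullback

    R′-elim : ∀ {y z} → ⟨ R′ ⟩ y z →
              ∃[ u ] ∃[ v ] ⟨ G ⟩ y u × ⟨ G ⟩ z v × ⟨ R ⟩ u v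
    R′-elim {y} {z} r with to (proj₂ (proj₂ pullback) y z) r
    ... | _ , _ , u , _ , v , _ , h = u , v , h

    R′-intro : ∀ {y z u v} → ⟨ G ⟩ y u → ⟨ G ⟩ z v → ⟨ R ⟩ u v → ⟨ R′ ⟩ y z
    R′-intro {y} {z} {u} {v} g k r
      with yˢ , uˢ ← ⟨⟩-sets g | zˢ , vˢ ← ⟨⟩-sets k =
      from (proj₂ (proj₂ pullback) y z) (yˢ , zˢ , u , uˢ , v , vˢ , g , k , r)

    E⇒G : ∀ {y u} → ⟨ E ⟩ y u → ⟨ G ⟩ y u
    E⇒G {y} {u} e with yˢ , uˢ ← ⟨⟩-sets e = from (G-char y u) (yˢ , uˢ , inj₁ e)

    G-total : ∀ y → y ∈ 𝕍 → ∃[ u ] u ∈ 𝕍 × ⟨ G ⟩ y u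
    G-total y y∈ with em {∃[ c ] IsSet c × ⟨ E ⟩ y c}
    ... | yes (c , cˢ , e) = c , isSet⇒∈𝕍 cˢ , E⇒G e
    ... | no ¬c = y , y∈ , from (G-char y y) ((_ , y∈) , (_ , y∈) , inj₂ (¬c , refl))

    G-functional : SingleValued G
    G-functional x y y′ g g′
      with to (G-char x y) g | to (G-char x y′) g′
    ... | _ , _ , inj₁ e  | _ , _ , inj₁ e′ = E-functional x y y′ e e′
    ... | _ , yˢ , inj₁ e | _ , _ , inj₂ (¬c , _) = contradiction (y , yˢ , e) ¬c
    ... | _ , _ , inj₂ (¬c , _) | _ , yˢ , inj₁ e = contradiction (y′ , yˢ , e) ¬c
    ... | _ , _ , inj₂ (_ , refl) | _ , _ , inj₂ (_ , refl) = refl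

    -- The value `w` of `z` under `G` fails to bound the values of `E`. A point `y` whose value is
    -- not below `w` is not below `z` in `R′`, and it lies in the domain of `E`, hence below `b`.
    initial-cofinal : ∀ z → z ∈ 𝕍 → ∃[ y ] ⟨ R ⟩ y b × ¬ ⟨ R′ ⟩ y z
    initial-cofinal z z∈ =
      let w , w∈ , g = G-total z z∈
          y , u , e , ¬r = E-cofinal w w∈
      in y , E-domain y u e , λ r′ → ¬r (compare e g (R′-elim r′))
      where
      compare : ∀ {y u w} → ⟨ E ⟩ y u → ⟨ G ⟩ z w →
                (∃[ u′ ] ∃[ w′ ] ⟨ G ⟩ y u′ × ⟨ G ⟩ z w′ × ⟨ R ⟩ u′ w′) → ⟨ R ⟩ u w
      compare e g (u′ , w′ , g₁ , g₂ , r)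
        with refl ← G-functional _ _ _ (E⇒G e) g₁ | refl ← G-functional _ _ _ g g₂ = r

    refinement : Preordering 𝕍 R′
    refinement = record
      { onX        = λ p p∈ →
          let x , y , o = proj₁ (proj₂ pullback) p p∈
              xˢ , yˢ = pair-members o
          in x , y , isSet⇒∈𝕍 xˢ , isSet⇒∈𝕍 yˢ , o
      ; reflexive  = λ x x∈ →
          let u , u∈ , g = G-total x x∈ in R′-intro g g (reflexive u u∈)
      ; transitive = λ x y z r s → compose (R′-elim r) (R′-elim s)
      ; total      = λ x y x∈ y∈ →
          let u , u∈ , g = G-total x x∈
              v , v∈ , k = G-total y y∈
          in Sum.map (R′-intro g k) (R′-intro k g) (total u v u∈ v∈)
      ; noLast     = λ (z , z∈ , last) →
          let y , r , ¬r′ = initial-cofinal z z∈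
          in ¬r′ (last y (isSet⇒∈𝕍 (proj₁ (⟨⟩-sets r))))
      }
      where
      compose : ∀ {x y z} →
        (∃[ u ] ∃[ v ] ⟨ G ⟩ x u × ⟨ G ⟩ y v × ⟨ R ⟩ u v) →
        (∃[ u ] ∃[ v ] ⟨ G ⟩ y u × ⟨ G ⟩ z v × ⟨ R ⟩ u v) → ⟨ R′ ⟩ x z
      compose (u , v , g , k , r) (v′ , w , k′ , l , s)
        with refl ← G-functional _ _ _ k k′ = R′-intro g l (transitive u v w r s)

    seg-refines : Seg 𝕍 R′ U.⊆ Seg 𝕍 R
    seg-refines (Y⊆ , x , x∈ , bound) =
      let w , w∈ , g = G-total x x∈
          m , m∈ , b≼m , w≼m = upperBound pre b w b∈𝕍 w∈
      in Y⊆ , m , m∈ , λ y y∈Y → below g b≼m w≼m (R′-elim (bound y y∈Y))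
      where
      below : ∀ {y w m} → ⟨ G ⟩ x w → ⟨ R ⟩ b m → ⟨ R ⟩ w m →
              (∃[ u ] ∃[ v ] ⟨ G ⟩ y u × ⟨ G ⟩ x v × ⟨ R ⟩ u v) → ⟨ R ⟩ y m
      below {y} g b≼m w≼m (u , v , k , g′ , r) with refl ← G-functional _ _ _ g g′
        with to (G-char y u) k
      ... | _ , _ , inj₁ e          = transitive y b _ (E-domain y u e) b≼m
      ... | _ , _ , inj₂ (_ , refl) = transitive y v _ r w≼m

    initial∉Seg : ¬ Seg 𝕍 R′ (initial R b)
    initial∉Seg (_ , x , x∈ , bound) =
      let y , r , ¬r′ = initial-cofinal x x∈
      in ¬r′ (bound y (from (∈-initial R y b) r))

  -- A diagonal argument in the style of König's theorem

  -- The equation `s = {z ∈ a : (b , z) ∈ v}`, written as two inclusions with bounded quantifiers so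
  -- that it is elementary.
  Section : (a v b s : Class) → Set ℓ
  Section a v b s = (∀ z → z ∈ s → z ∈ a × ⟨ v ⟩ b z)
                    × (∀ z → z ∈ a → ⟨ v ⟩ b z → z ∈ s)

  -- The conjunct `c ∈ s` leaves the value undefined when the section is empty, where `choice` says
  -- nothing about `F`.
  Value : (a F v b c : Class) → Set ℓ
  Value a F v b c = ∃[ s ] IsSet s × Section a v b s × ⟨ F ⟩ s c × c ∈ s

  opaque
    valueᵉ : (a F v b c : Fin n) →
             Elem (λ ρ → Value (lookup ρ a) (lookup ρ F)
                               (lookup ρ v) (lookup ρ b) (lookup ρ c))
    valueᵉ a F v b c = ∃ᵉ
      (∀∈ᵉ v0 (v0 ∈ᵉ suc (suc a) ∧ᵉ relᵉ (suc (suc v)) (suc (suc b)) v0)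
       ∧ᵉ ∀∈ᵉ (suc a) (relᵉ (suc (suc v)) (suc (suc b)) v0 ⇒ᵉ v0 ∈ᵉ v1))
      ∧ᵉ relᵉ (suc F) v0 (suc c) ∧ᵉ suc c ∈ᵉ v0

  value-functional : ∀ {a F v b c c′} → SingleValued F →
                     Value a F v b c → Value a F v b c′ → c ≡ c′
  value-functional F-fun (s , _ , (f , g) , r , _) (s′ , _ , (f′ , g′) , r′ , _)
    with refl ← extensionality s s′ (λ z → mk⇔
           (λ z∈ → let z∈a , q = f z z∈ in g′ z z∈a q)
           (λ z∈ → let z∈a , q = f′ z z∈ in g z z∈a q)) = F-fun s _ _ r r′

  module Diagonal {R : Class} (pre : Preordering 𝕍 R)
    {a : Class} (a∈𝕍 : a ∈ 𝕍) (a-cofinal : ¬ Seg 𝕍 R a)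
    {F : Class}
    (F-choice : ∀ x → IsSet x → (∃[ z ] z ∈ x) → ∃[ y ] y ∈ x × ⟨ F ⟩ x y)
    where

    open Preordering pre

    Bounds : Class → Class → Set ℓ
    Bounds b d = ∀ v → ⟨ R ⟩ v b → ∀ e → Value a F v b e → ⟨ R ⟩ e d

    -- By totality, `c` is strictly above all values at `b` of relations `v ≼ b`. The quantifiers
    -- range over sets, so `diagonal` needs only elementary comprehension.
    Avoids : Class → Class → Set ℓ
    Avoids b c = ∀ v → IsSet v → ⟨ R ⟩ v b →
                 ∀ e → IsSet e → Value a F v b e → ¬ ⟨ R ⟩ c e

    opaque
      diagonal : ∃[ h ] (∀ p → p ∈ h → ∃[ x ] ∃[ y ] IsOrderedPair p x y)
        × (∀ b c → ⟨ h ⟩ b c ⇔ (IsSet b × IsSet c × b ∈ a × c ∈ a × Avoids b c))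
      diagonal = relation (R ∷ a ∷ F ∷ []) _
        (v1 ∈ᵉ v4 ∧ᵉ v0 ∈ᵉ v4 ∧ᵉ
         (∀ᵉ relᵉ v4 v0 v2 ⇒ᵉ
           ∀ᵉ valueᵉ v6 v7 v1 v3 v0 ⇒ᵉ ¬ᵉ relᵉ v5 v2 v0))
        λ _ _ _ → refl

    h : Class
    h = proj₁ diagonal

    h-char : ∀ b c → ⟨ h ⟩ b c ⇔ (IsSet b × IsSet c × b ∈ a × c ∈ a × Avoids b c)
    h-char = proj₂ (proj₂ diagonal)

    -- Being a set, the diagonal relation `h` is itself one of the relations over which `Avoids`
    -- quantifies.
    h-isSet : IsSet h
    h-isSet = graph-isSet (_ , a∈𝕍) λ p p∈h →
      let x , y , o = proj₁ (proj₂ diagonal) p p∈h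
          _ , _ , x∈a , y∈a , _ = to (h-char x y) (p , o , p∈h)
      in x , y , x∈a , y∈a , o

    -- If the values at b were bounded by d, then h would have a value at b,
    -- which h itself avoids.

    no-bound : ∀ {b d} → b ∈ a → ⟨ R ⟩ h b → d ∈ 𝕍 → ¬ Bounds b d
    no-bound {b} {d} b∈a h≼b d∈ bounds =
      let c , c∈a , _ , ¬c≼d = seg-cofinal pre a-cofinal d d∈
          c-avoids : Avoids b c
          c-avoids = λ v _ v≼b e _ val c≼e →
            ¬c≼d (transitive c e d c≼e (bounds v v≼b e val))
          -- The section of `h` at `b`; it contains `c`, so `F` chooses from it a value `e` of `h`
          -- at `b`.
          s , hs = comprehend (h ∷ a ∷ b ∷ []) (v0 ∈ᵉ v2 ∧ᵉ relᵉ v1 v3 v0)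
          sˢ = ⊆-isSet (_ , a∈𝕍) λ z z∈s → proj₁ (proj₂ (to (hs z) z∈s))
          c∈s = from (hs c)
            ((_ , c∈a) , c∈a , from (h-char b c)
              ((_ , b∈a) , (_ , c∈a) , b∈a , c∈a , c-avoids))
          e , e∈s , chosen = F-choice s sˢ (c , c∈s)
          val : Value a F h b e
          val = s , sˢ
              , ( (λ z → proj₂ ∘ to (hs z))
                , (λ z z∈a r → from (hs z) ((_ , z∈a) , z∈a , r)) )
              , chosen , e∈s
          _ , _ , _ , _ , e-avoids = to (h-char b e) (proj₂ (proj₂ (to (hs e) e∈s)))
      in e-avoids h h-isSet h≼b e (_ , e∈s) val (reflexive e (isSet⇒∈𝕍 (_ , e∈s)))

    -- Cofinality of `a` supplies `b ∈ a` with `h ≼ b`, so that `h` is among the relations whose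
    -- values at `b` are considered.
    unbounded-values : ∃[ b ] b ∈ 𝕍 × (∀ d → d ∈ 𝕍 → ¬ Bounds b d)
    unbounded-values =
      let h∈ = isSet⇒∈𝕍 h-isSet
          b , b∈a , b∈ , ¬b≼h = seg-cofinal pre a-cofinal h h∈
      in b , b∈ , λ d d∈ → no-bound b∈a (¬≼⇒≽ pre h∈ b∈ ¬b≼h) d∈

  -- Uniqueness of the minimal access ideal

  sets⊆minimal : ∀ I → MinimalAccessIdeal 𝕍 I → (_∈ 𝕍) U.⊆ I
  sets⊆minimal I ((_ , R , pre , seg⊆I) , minimal) {a} a∈ = dne λ ¬Ia →
    let F , F-functional , F-choice = choice
        b , b∈ , unbounded =
          Diagonal.unbounded-values pre a∈ (¬Ia ∘ seg⊆I) F-choice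
        E , _ , E-char = relation (R ∷ a ∷ F ∷ b ∷ [])
          (λ v c → ⟨ R ⟩ v b × Value a F v b c)
          (relᵉ v3 v1 v6 ∧ᵉ valueᵉ v4 v5 v1 v6 v0) (λ _ _ _ → refl)
    in contradict F-functional b∈ unbounded E E-char
    where
    contradict : ∀ {F b} → SingleValued F → b ∈ 𝕍 →
      (∀ d → d ∈ 𝕍 →
        ¬ (∀ v → ⟨ R ⟩ v b → ∀ e → Value a F v b e → ⟨ R ⟩ e d)) →
      ∀ E → (∀ v c → ⟨ E ⟩ v c ⇔ (IsSet v × IsSet c × ⟨ R ⟩ v b × Value a F v b c)) →
      ⊥
    contradict {F} {b} F-functional b∈ unbounded E E-char =
      -- The inclusion in `I` is proper: `initial R b` is `R`-bounded and so in `I`, but it is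
      -- cofinal for `R′`.
      minimal (Seg 𝕍 R′) (seg-ideal refinement)
        ( (seg⊆I ∘ seg-refines)
        , λ I⊆ → initial∉Seg (I⊆ (seg⊆I (initial∈Seg R b∈))))
        (R′ , refinement , id)
      where
      open Refinement pre {E}
        (λ v c c′ r r′ → value-functional F-functional
          (proj₂ (proj₂ (proj₂ (to (E-char v c) r))))
          (proj₂ (proj₂ (proj₂ (to (E-char v c′) r′)))))
        b∈
        (λ v c r → proj₁ (proj₂ (proj₂ (to (E-char v c) r))))
        -- If every value of `E` were below `d`, then `d` would bound all values at `b`.
        (λ d d∈ → dne λ none → unbounded d d∈ λ v r e val → dne λ ¬r →
          none (v , e , from (E-char v e)
            (proj₁ (⟨⟩-sets r) , (_ , proj₂ (proj₂ (proj₂ (proj₂ val)))) , r , val) , ¬r))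

  -- The sets form an access ideal contained in `I`, and minimality of `I` rules out that this
  -- inclusion is proper.
  minimal≐sets : ∀ I → MinimalAccessIdeal 𝕍 I → I ≐ (_∈ 𝕍)
  minimal≐sets I minI@(_ , minimal) =
    (λ {Y} → dne λ ¬⊆ → minimal (_∈ 𝕍) 𝕍-ideal
       (sets⊆minimal I minI , λ I⊆𝕍 → ¬⊆ I⊆𝕍) 𝕍-accessible)
    , sets⊆minimal I minI

theorem2p5 : {ℓ : Level} → ExcludedMiddle ℓ →
    (𝔐 : Structure ℓ) → let open ClassTheory 𝔐 in
    (gbc : GBC) → let open GBC gbc in
    MinimalAccessIdeal 𝕍 (_∈ 𝕍)
    × (∀ (I : Pred Class ℓ) → MinimalAccessIdeal 𝕍 I → I ≐ (_∈ 𝕍))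
theorem2p5 em 𝔐 gbc = 𝕍-minimal , minimal≐sets
  where open Development em 𝔐 gbc
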